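{- Let $\Sigma_{\mathsf{BPCP}}=(\{\star^0,e^0,f_{\mathsf{tt}}^1,f_{\mathsf{ff}}^1\};\{P^2,\prec^2,\equiv^2\})$ be the signature with two constants $\star,e$, two unary function symbols $f_{\mathsf{tt}},f_{\mathsf{ff}}$ and three binary relation symbols $P,\prec,\equiv$. Then $\mathsf{BPCP}\preceq\mathsf{FSATEQ}(\Sigma_{\mathsf{BPCP}};\equiv)$.
   Context: We work in constructive type theory (as in Coq), where all definable functions are computable. $p\preceq q$ (many-one reduction) means there is a function $f$ with $p\,x\leftrightarrow q(f\,x)$ for all $x$. A predicate is decidable if a Boolean function characterises it. A type is finite if some list contains all of its elements. $\mathsf{BPCP}$: an instance is a list $R$ of pairs $s/t$ of Boolean strings. $R\triangleright s/t$ is inductively defined: it holds if $s/t\in R$; and if $s/t\in R$ and $R\triangleright u/v$ then $R\triangleright (s\mathbin{++}u)/(t\mathbin{++}v)$. $\mathsf{BPCP}\,R$ iff $\exists s.\,R\triangleright s/s$. First-order formulas over a signature are built from $\dot\bot$, atoms, $\dot\to,\dot\land,\dot\lor,\dot\forall,\dot\exists$. A model over a domain type $D$ interprets each function symbol $f$ as $D^{|f|}\to D$ and each relation symbol $P$ as $D^{|P|}\to\mathbb P$, with Tarski satisfaction $\mathcal M\vDash_\rho\varphi$ for $\rho:\mathbb N\to D$. The model is decidable if every relation interpretation is decidable. For a binary relation symbol $\equiv$ of $\Sigma$, $\mathsf{FSATEQ}(\Sigma;\equiv)\,\varphi$ holds iff there exist a finite type $D$, a decidable model $\mathcal M$ over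 $D$ with $\equiv^{\mathcal M}x\,y\leftrightarrow x=y$ for all $x,y$, and an assignment $\rho$ with $\mathcal M\vDash_\rho\varphi$. -}

module Defs where

open import Data.Bool.Base using (Bool; true)
open import Data.Empty using (⊥)
open import Data.List.Base using (List; _++_)
open import Data.List.Membership.Propositional using (_∈_)
open import Data.Nat.Base using (ℕ; zero; suc)
open import Data.Product using (Σ-syntax; ∃-syntax; _×_; _,_)
open import Data.Sum.Base using (_⊎_)
open import Data.Vec.Base using (Vec; []; _∷_)
open import Function.Bundles using (_⇔_)
open import Level using (Level; _⊔_)
open import Relation.Binary.PropositionalEquality using (_≡_; refl; sym; subst)
open import Relation.Unary using (Pred)

private
  variable
    a b p q : Level

infix 4 _⪯_

_⪯_ : {X : Set a} {Y : Set b} → Pred X p → Pred Y q → Set (a ⊔ b ⊔ p ⊔ q)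
_⪯_ {X = X} {Y = Y} P Q = Σ[ f ∈ (X → Y) ] (∀ x → P x ⇔ Q (f x))

IsDecidable : {A : Set a} → Pred A p → Set (a ⊔ p)
IsDecidable {A = A} P = Σ[ f ∈ (A → Bool) ] (∀ x → P x ⇔ f x ≡ true)

IsFinite : Set a → Set a
IsFinite A = Σ[ xs ∈ List A ] (∀ x → x ∈ xs)

BString : Set
BString = List Bool

Stack : Set
Stack = List (BString × BString)

infix 4 _▷_/_

data _▷_/_ (R : Stack) : BString → BString → Set where
  base : ∀ {s t} → (s , t) ∈ R → R ▷ s / t
  step : ∀ {s t u v} → (s , t) ∈ R → R ▷ u / v → R ▷ s ++ u / t ++ v

BPCP : Stack → Set
BPCP R = ∃[ s ] (R ▷ s / s)

record Signature : Set₁ where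
  field
    Fun   : Set
    Rel   : Set
    funAr : Fun → ℕ
    relAr : Rel → ℕ

open Signature public

data Term (S : Signature) : Set where
  var  : ℕ → Term S
  func : (f : Fun S) → Vec (Term S) (funAr S f) → Term S

infixr 5 _→̇_
infixr 6 _∨̇_
infixr 7 _∧̇_

-- Variables are de Bruijn indices: a quantifier binds index 0 in its body.
data Formula (S : Signature) : Set where
  ⊥̇    : Formula S
  atom : (P : Rel S) → Vec (Term S) (relAr S P) → Formula S
  _→̇_  : Formula S → Formula S → Formula S
  _∧̇_  : Formula S → Formula S → Formula S
  _∨̇_  : Formula S → Formula S → Formula S
  ∀̇_   : Formula S → Formula S
  ∃̇_   : Formula S → Formula S

record Model (S : Signature) (D : Set) : Set₁ where
  field
    funI : (f : Fun S) → Vec D (funAr S f) → D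
    relI : (P : Rel S) → Vec D (relAr S P) → Set

open Model public

infixr 5 _∙_

_∙_ : {D : Set} → D → (ℕ → D) → ℕ → D
(d ∙ ρ) zero    = d
(d ∙ ρ) (suc n) = ρ n

module _ {S : Signature} {D : Set} (M : Model S D) where

  -- evals is Vec.map (eval ρ), unfolded for the termination checker.
  mutual
    eval : (ℕ → D) → Term S → D
    eval ρ (var n)     = ρ n
    eval ρ (func f ts) = funI M f (evals ρ ts)

    evals : ∀ {n} → (ℕ → D) → Vec (Term S) n → Vec D n
    evals ρ []       = []
    evals ρ (t ∷ ts) = eval ρ t ∷ evals ρ ts

infix 4 _⊨[_]_

_⊨[_]_ : {S : Signature} {D : Set} → Model S D → (ℕ → D) → Formula S → Set
M ⊨[ ρ ] ⊥̇         = ⊥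
M ⊨[ ρ ] atom P ts = relI M P (evals M ρ ts)
M ⊨[ ρ ] (φ →̇ ψ)   = M ⊨[ ρ ] φ → M ⊨[ ρ ] ψ
M ⊨[ ρ ] (φ ∧̇ ψ)   = (M ⊨[ ρ ] φ) × (M ⊨[ ρ ] ψ)
M ⊨[ ρ ] (φ ∨̇ ψ)   = (M ⊨[ ρ ] φ) ⊎ (M ⊨[ ρ ] ψ)
M ⊨[ ρ ] (∀̇ φ)     = ∀ d → M ⊨[ d ∙ ρ ] φ
M ⊨[ ρ ] (∃̇ φ)     = ∃[ d ] (M ⊨[ d ∙ ρ ] φ)

IsDecidableModel : {S : Signature} {D : Set} → Model S D → Set
IsDecidableModel {S} M = (P : Rel S) → IsDecidable (relI M P)

binary : {S : Signature} {D : Set} → Model S D →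
         (P : Rel S) → relAr S P ≡ 2 → D → D → Set
binary {D = D} M P ar x y = relI M P (subst (Vec D) (sym ar) (x ∷ y ∷ []))

FSATEQ : (S : Signature) (E : Rel S) → relAr S E ≡ 2 → Formula S → Set₁
FSATEQ S E ar φ =
  Σ[ D ∈ Set ] Σ[ M ∈ Model S D ] Σ[ ρ ∈ (ℕ → D) ]
    (IsFinite D
    × IsDecidableModel M
    × (∀ x y → binary M E ar x y ⇔ x ≡ y)
    × M ⊨[ ρ ] φ)

data FunBPCP : Set where
  ⋆ᶠ eᶠ ttᶠ ffᶠ : FunBPCP

data RelBPCP : Set where
  Pʳ ≺ʳ ≡ʳ : RelBPCP

funArBPCP : FunBPCP → ℕ
funArBPCP ⋆ᶠ  = 0
funArBPCP eᶠ  = 0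
funArBPCP ttᶠ = 1
funArBPCP ffᶠ = 1

relArBPCP : RelBPCP → ℕ
relArBPCP Pʳ = 2
relArBPCP ≺ʳ = 2
relArBPCP ≡ʳ = 2

ΣBPCP : Signature
ΣBPCP = record
  { Fun = FunBPCP ; Rel = RelBPCP ; funAr = funArBPCP ; relAr = relArBPCP }

{-# OPTIONS --safe #-}

-- A model encodes strings as e-terminated stacks of f_tt and f_ff, and P as
-- the set of derivable pairs.  Given R ▷ s / s, the strings of length at most
-- |s| form a model with the overflow value ⋆, where P is the finite set of
-- pairs occurring in the derivation.  Conversely ≺ is well-founded in every
-- finite model, so unfolding P along the lexicographic order on pairs yields a
-- derivation, and injectivity of the stack operations away from ⋆ turns
-- P x x into a solution.
module Submission where

open import Defs
open import Data.Bool.Base using (Bool; true; false)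
import Data.Bool.Properties as Bool
open import Data.Empty using (⊥)
open import Data.Fin.Base using (Fin)
open import Data.Fin.Induction using (spo-wellFounded)
open import Data.List.Base as List using (List; []; _∷_; _++_; foldr; length; concatMap)
open import Data.List.Membership.Propositional using (_∈_; find; lose)
open import Data.List.Membership.Propositional.Properties using (∈-concatMap⁺; ∈-map⁺)
open import Data.List.Membership.DecPropositional using (_∈?_)
open import Data.List.Properties
  using (++-identityʳ; foldr-++; length-++-≤ʳ) renaming (≡-dec to List-≡-dec)
open import Data.List.Relation.Unary.Any as Any using (Any; here; there)
open import Data.List.Relation.Unary.Any.Properties using (lookup-index)
open import Data.Maybe.Base using (Maybe; just; nothing)
open import Data.Maybe.Properties using () renaming (≡-dec to Maybe-≡-dec)
open import Data.Nat.Base using (ℕ; zero; suc; _≤_; _<_; z≤n; s≤s)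
open import Data.Nat.Properties
  using (≤-refl; ≤-trans; ≤-irrelevant; <-irrefl; <-trans; _≤?_; _<?_; n≤1+n)
open import Data.Product as Product using (∃-syntax; _×_; _,_; proj₁; proj₂)
open import Data.Product.Relation.Binary.Lex.Strict using (×-Lex; ×-wellFounded)
open import Data.Product.Properties using () renaming (≡-dec to Σ-≡-dec)
open import Data.Sum.Base as Sum using (_⊎_; inj₁; inj₂)
open import Data.Vec.Base using (Vec; []; _∷_)
open import Function.Base using (_∘_; _on_)
open import Function.Bundles using (_⇔_; mk⇔; Equivalence)
open import Induction.WellFounded using (WellFounded; Acc; acc)
open import Relation.Binary.Definitions using (DecidableEquality; Transitive)
open import Relation.Binary.Structures using (IsStrictPartialOrder)
open import Relation.Binary.PropositionalEquality
  using (_≡_; _≢_; refl; sym; trans; cong; subst; subst₂; resp₂; isEquivalence)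
open import Relation.Nullary using (yes; no; does; ¬_; contradiction)
open import Relation.Nullary.Decidable using (dec-true)
open import Relation.Unary using (Pred; Decidable)

open Equivalence using (to; from)

-- Boolean deciders, and well-foundedness on finite types.

decidable : ∀ {a p} {A : Set a} {P : Pred A p} → Decidable P → IsDecidable P
decidable {P = P} P? = (λ x → does (P? x)) , λ x → mk⇔ (dec-true (P? x)) (holds x)
  where
  holds : ∀ x → does (P? x) ≡ true → P x
  holds x _ with yes p ← P? x = p

-- Pulled back to the positions in the enumeration, the relation is a strict partial order on some
-- `Fin n`, where well-foundedness is known. Repetitions in `xs` do no harm: looking up the chosen
-- position of an element returns that element, so accessibility transfers back.
finite-wellFounded : ∀ {A : Set} {_≺_ : A → A → Set} → IsFinite A →
                     (∀ x → ¬ x ≺ x) → Transitive _≺_ → WellFounded _≺_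
finite-wellFounded {A} {_≺_} (xs , all) irrefl ≺-trans x =
  accessible x (spo-wellFounded ⊏-isStrictPartialOrder (position x))
  where
  position : A → Fin (length xs)
  position = Any.index ∘ all

  lookup-position : ∀ x → x ≡ List.lookup xs (position x)
  lookup-position = lookup-index ∘ all

  _⊏_ : Fin (length xs) → Fin (length xs) → Set
  _⊏_ = _≺_ on List.lookup xs

  ⊏-isStrictPartialOrder : IsStrictPartialOrder _≡_ _⊏_
  ⊏-isStrictPartialOrder = record
    { isEquivalence = isEquivalence
    ; irrefl        = λ { refl → irrefl _ }
    ; trans         = ≺-trans
    ; <-resp-≈      = resp₂ _⊏_
    }

  accessible : ∀ x → Acc _⊏_ (position x) → Acc _≺_ x
  accessible x (acc rs) = acc λ {y} y≺x →
    accessible y (rs (subst₂ _≺_ (lookup-position y) (lookup-position x) y≺x))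

-- The formula assigned to a stack.

infix  8 _≡̇_ _≺̇_
infixr 9 _·_

Tm Fm : Set
Tm = Term ΣBPCP
Fm = Formula ΣBPCP

⋆̇ ė : Tm
⋆̇ = func ⋆ᶠ []
ė = func eᶠ []

ḟ : Bool → Tm → Tm
ḟ true  t = func ttᶠ (t ∷ [])
ḟ false t = func ffᶠ (t ∷ [])

_·_ : BString → Tm → Tm
s · t = foldr ḟ t s

_≡̇_ _≺̇_ Ṗ : Tm → Tm → Fm
t ≡̇ u = atom ≡ʳ (t ∷ u ∷ [])
t ≺̇ u = atom ≺ʳ (t ∷ u ∷ [])
Ṗ t u = atom Pʳ (t ∷ u ∷ [])

¬̇_ : Fm → Fm
¬̇ φ = φ →̇ ⊥̇

⋁ : {A : Set} → List A → (A → Fm) → Fm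
⋁ xs φ = foldr (λ x ψ → φ x ∨̇ ψ) ⊥̇ xs

⋀ᵇ : (Bool → Fm) → Fm
⋀ᵇ φ = φ true ∧̇ φ false

-- The pair to be decomposed is (var 1, var 0); below ∃̇ ∃̇ it becomes
-- (var 3, var 2), and (var 1, var 0) is the rest of it after the card.
card : BString × BString → Fm
card (s , t) =
    (var 1 ≡̇ s · ė ∧̇ var 0 ≡̇ t · ė)
  ∨̇ (∃̇ ∃̇ (Ṗ (var 1) (var 0)
         ∧̇ var 3 ≡̇ s · var 1
         ∧̇ var 2 ≡̇ t · var 0
         ∧̇ (var 1 ≺̇ var 3 ∨̇ (var 1 ≡̇ var 3 ∧̇ var 0 ≺̇ var 2))))

-- On a finite domain an injective operation is onto and would reach `ė`, against `nonempty`. Hence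
-- `injective` and `disjoint` make an exception for the value `⋆̇`, which `overflow` makes
-- absorbing.
overflow nonempty injective disjoint irreflexive transitive solvable : Fm
overflow    = ⋀ᵇ λ b → ḟ b ⋆̇ ≡̇ ⋆̇
nonempty    = ⋀ᵇ λ b → ∀̇ ¬̇ (ḟ b (var 0) ≡̇ ė)
injective   = ⋀ᵇ λ b → ∀̇ ∀̇ (ḟ b (var 1) ≡̇ ḟ b (var 0) →̇
                              ¬̇ (ḟ b (var 1) ≡̇ ⋆̇) →̇ var 1 ≡̇ var 0)
disjoint    = ∀̇ ∀̇ (ḟ true (var 1) ≡̇ ḟ false (var 0) →̇ ḟ true (var 1) ≡̇ ⋆̇)
irreflexive = ∀̇ ¬̇ (var 0 ≺̇ var 0)
transitive  = ∀̇ ∀̇ ∀̇ (var 2 ≺̇ var 1 →̇ var 1 ≺̇ var 0 →̇ var 2 ≺̇ var 0)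
solvable    = ∃̇ (Ṗ (var 0) (var 0) ∧̇ ¬̇ (var 0 ≡̇ ⋆̇))

-- Closure of `P` under the cards is not demanded, which lets the pairs of a single derivation
-- interpret `P`.
derivable : Stack → Fm
derivable R = ∀̇ ∀̇ (Ṗ (var 1) (var 0) →̇ ⋁ R card)

encode : Stack → Fm
encode R = overflow ∧̇ nonempty ∧̇ injective ∧̇ disjoint ∧̇ irreflexive ∧̇ transitive
         ∧̇ derivable R ∧̇ solvable

-- Evaluation of string terms and of finite disjunctions.

module _ {D : Set} (M : Model ΣBPCP D) where

  app : Bool → D → D
  app true  d = funI M ttᶠ (d ∷ [])
  app false d = funI M ffᶠ (d ∷ [])

  eval-· : ∀ ρ s t → eval M ρ (s · t) ≡ foldr app (eval M ρ t) s
  eval-· ρ []          t = refl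
  eval-· ρ (true  ∷ s) t = cong (app true)  (eval-· ρ s t)
  eval-· ρ (false ∷ s) t = cong (app false) (eval-· ρ s t)

  ⊨-⋁ : ∀ {A : Set} {ρ} (xs : List A) (φ : A → Fm) →
        M ⊨[ ρ ] ⋁ xs φ ⇔ Any (λ x → M ⊨[ ρ ] φ x) xs
  ⊨-⋁ xs φ = mk⇔ (⇒ xs) ⇐
    where
    ⇒ : ∀ xs → M ⊨[ _ ] ⋁ xs φ → Any (λ x → M ⊨[ _ ] φ x) xs
    ⇒ (x ∷ xs) (inj₁ p) = here p
    ⇒ (x ∷ xs) (inj₂ p) = there (⇒ xs p)

    ⇐ : ∀ {xs} → Any (λ x → M ⊨[ _ ] φ x) xs → M ⊨[ _ ] ⋁ xs φ
    ⇐ (here p)  = inj₁ p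
    ⇐ (there p) = inj₂ (⇐ p)

-- From solutions to models.

pairs : ∀ {R s t} → R ▷ s / t → Stack
pairs (base {s} {t} _)           = (s , t) ∷ []
pairs (step {s} {t} {u} {v} _ d) = (s ++ u , t ++ v) ∷ pairs d

root∈pairs : ∀ {R s t} (d : R ▷ s / t) → (s , t) ∈ pairs d
root∈pairs (base _)   = here refl
root∈pairs (step _ _) = here refl

-- The counterpart of `card` on actual strings, with `T` for `P` and comparison of lengths for `≺`.
data Decomposes (R T : Stack) : BString → BString → Set where
  last : ∀ {s t} → (s , t) ∈ R → Decomposes R T s t
  more : ∀ {s t u v} → (s , t) ∈ R → (u , v) ∈ T →
         length u < length (s ++ u) ⊎ (u ≡ s ++ u × length v < length (t ++ v)) →
         Decomposes R T (s ++ u) (t ++ v)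

Decomposes-there : ∀ {R T c x y} → Decomposes R T x y → Decomposes R (c ∷ T) x y
Decomposes-there (last st∈R)         = last st∈R
Decomposes-there (more st∈R uv∈T lt) = more st∈R (there uv∈T) lt

length-++-<ʳ : ∀ (b : Bool) s u → length u < length (b ∷ s ++ u)
length-++-<ʳ b s u = s≤s (length-++-≤ʳ u {s})

-- A card ε/ε makes no progress, so it is skipped.
pairs-decompose : ∀ {R s t x y} (d : R ▷ s / t) → (x , y) ∈ pairs d →
                  Decomposes R (pairs d) x y
pairs-decompose (base st∈R) (here refl) = last st∈R
pairs-decompose (step {[]}     {[]}    _    d) (here refl) =
  Decomposes-there (pairs-decompose d (root∈pairs d))
pairs-decompose (step {[]}     {b ∷ t} {v = v} st∈R d) (here refl) =
  more st∈R (there (root∈pairs d)) (inj₂ (refl , length-++-<ʳ b t v))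
pairs-decompose (step {b ∷ s} {u = u} st∈R d) (here refl) =
  more st∈R (there (root∈pairs d)) (inj₁ (length-++-<ʳ b s u))
pairs-decompose (step _ d) (there xy∈) = Decomposes-there (pairs-decompose d xy∈)

-- Finiteness of the domain.

Bounded : ℕ → Set
Bounded n = ∃[ u ] (length {A = Bool} u ≤ n)

Bounded-≡ : ∀ {n} {x y : Bounded n} → proj₁ x ≡ proj₁ y → x ≡ y
Bounded-≡ {x = u , p} {_ , q} refl = cong (u ,_) (≤-irrelevant p q)

cons : ∀ {n} → Bool → Bounded n → Bounded (suc n)
cons b (u , u≤n) = b ∷ u , s≤s u≤n

Bounded-finite : ∀ n → IsFinite (Bounded n)
Bounded-finite n = elements n , complete n
  where
  extensions : ∀ {n} → Bounded n → List (Bounded (suc n))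
  extensions x = cons true x ∷ cons false x ∷ []

  ∈-extensions : ∀ {n} b (x : Bounded n) → cons b x ∈ extensions x
  ∈-extensions true  x = here refl
  ∈-extensions false x = there (here refl)

  elements : ∀ n → List (Bounded n)
  elements zero    = ([] , z≤n) ∷ []
  elements (suc n) = ([] , z≤n) ∷ concatMap extensions (elements n)

  complete : ∀ n (x : Bounded n) → x ∈ elements n
  complete zero    ([] , z≤n)        = here refl
  complete (suc n) ([] , z≤n)        = here refl
  complete (suc n) (b ∷ u , s≤s u≤n) =
    there (∈-concatMap⁺ extensions (lose (complete n (u , u≤n)) (∈-extensions b (u , u≤n))))

Maybe-finite : ∀ {A : Set} → IsFinite A → IsFinite (Maybe A)
Maybe-finite (xs , all) = nothing ∷ List.map just xs , λ
  { nothing  → here refl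
  ; (just x) → there (∈-map⁺ just (all x))
  }

-- The model of bounded strings with overflow.

module BoundedModel (n : ℕ) (T : Stack) where

  D : Set
  D = Maybe (Bounded n)

  push : Bool → D → D
  push b nothing = nothing
  push b (just (u , _)) with suc (length u) ≤? n
  ... | yes 1+u≤n = just (b ∷ u , 1+u≤n)
  ... | no  _     = nothing

  push-fits : ∀ b u u≤n bu≤n → push b (just (u , u≤n)) ≡ just (b ∷ u , bu≤n)
  push-fits b u u≤n bu≤n with suc (length u) ≤? n
  ... | yes _    = cong just (Bounded-≡ refl)
  ... | no  bu≰n = contradiction bu≤n bu≰n

  push-just : ∀ {b d x} → push b d ≡ just x → ∃[ y ] (d ≡ just y × proj₁ x ≡ b ∷ proj₁ y)
  push-just {d = just (u , _)} eq with suc (length u) ≤? n | eq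
  ... | yes _ | refl = _ , refl , refl

  -- A value other than `nothing` rules out overflow on both sides. By `push-just` both are then
  -- proper extensions of strings, and heads and tails can be compared.
  push-injective : ∀ {b c d d′} → push b d ≡ push c d′ → push b d ≢ nothing → b ≡ c × d ≡ d′
  push-injective {b} {c} {d} {d′} eq ≢⋆ with push b d in eqˡ
  ... | nothing = contradiction refl ≢⋆
  ... | just x
    with y , refl , x≡by ← push-just {b} {d} eqˡ
       | z , refl , x≡cz ← push-just {c} {d′} (sym eq)
    with refl ← trans (sym x≡by) x≡cz = refl , cong just (Bounded-≡ refl)

  -- The bound on the final string passes to its suffixes, so no intermediate `push` overflows.
  foldr-push : ∀ s {u u≤n su≤n} → foldr push (just (u , u≤n)) s ≡ just (s ++ u , su≤n)
  foldr-push []      = cong just (Bounded-≡ refl)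
  foldr-push (b ∷ s) {su≤n = bsu≤n} =
    trans (cong (push b) (foldr-push s {su≤n = su≤n})) (push-fits b _ su≤n bsu≤n)
    where su≤n = ≤-trans (n≤1+n _) bsu≤n

  In : D → D → Set
  In (just (u , _)) (just (v , _)) = (u , v) ∈ T
  In _              _              = ⊥

  -- Comparing lengths inherits irreflexivity and transitivity from `ℕ`, and removing a nonempty
  -- prefix always descends.
  Shorter : D → D → Set
  Shorter (just (u , _)) (just (v , _)) = length u < length v
  Shorter _              _              = ⊥

  M : Model ΣBPCP D
  M = record { funI = funI′ ; relI = relI′ }
    where
    funI′ : (f : FunBPCP) → Vec D (funArBPCP f) → D
    funI′ ⋆ᶠ  []       = nothing
    funI′ eᶠ  []       = just ([] , z≤n)
    funI′ ttᶠ (d ∷ []) = push true d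
    funI′ ffᶠ (d ∷ []) = push false d

    relI′ : (P : RelBPCP) → Vec D (relArBPCP P) → Set
    relI′ Pʳ (x ∷ y ∷ []) = In x y
    relI′ ≺ʳ (x ∷ y ∷ []) = Shorter x y
    relI′ ≡ʳ (x ∷ y ∷ []) = x ≡ y

  M-decidable : IsDecidableModel M
  M-decidable = decidable ∘ dec
    where
    _≟ˢ_ : DecidableEquality BString
    _≟ˢ_ = List-≡-dec Bool._≟_

    dec : ∀ P → Decidable (relI M P)
    dec Pʳ (just (u , _) ∷ just (v , _) ∷ []) = _∈?_ (Σ-≡-dec _≟ˢ_ _≟ˢ_) (u , v) T
    dec Pʳ (just _ ∷ nothing ∷ []) = no λ ()
    dec Pʳ (nothing ∷ _ ∷ [])      = no λ ()
    dec ≺ʳ (just (u , _) ∷ just (v , _) ∷ []) = length u <? length v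
    dec ≺ʳ (just _ ∷ nothing ∷ []) = no λ ()
    dec ≺ʳ (nothing ∷ _ ∷ [])      = no λ ()
    dec ≡ʳ (x ∷ y ∷ [])            =
      Maybe-≡-dec (Σ-≡-dec _≟ˢ_ λ p q → yes (≤-irrelevant p q)) x y

  -- Satisfaction of the encoding in the bounded model.

  app≗push : ∀ s {d} → foldr (app M) d s ≡ foldr push d s
  app≗push []          = refl
  app≗push (true  ∷ s) = cong (push true) (app≗push s)
  app≗push (false ∷ s) = cong (push false) (app≗push s)

  eval-push : ∀ ρ s t {u u≤n su≤n} → eval M ρ t ≡ just (u , u≤n) →
              just (s ++ u , su≤n) ≡ eval M ρ (s · t)
  eval-push ρ s t eq = sym (trans (eval-· M ρ s t)
    (trans (app≗push s) (trans (cong (λ d → foldr push d s) eq) (foldr-push s))))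

  ⊨-derivable : ∀ {R ρ} → (∀ {x y} → (x , y) ∈ T → Decomposes R T x y) → M ⊨[ ρ ] derivable R
  -- Pairs with a component `nothing` do not arise, since `In` is empty on them.
  ⊨-derivable {R} {ρ} dec (just (x , x≤n)) (just (y , y≤n)) xy∈T =
    from (⊨-⋁ M R card) (disjunct x≤n y≤n (dec xy∈T))
    where
    disjunct : ∀ {x y} x≤n y≤n → Decomposes R T x y →
               Any (λ c → M ⊨[ just (y , y≤n) ∙ just (x , x≤n) ∙ ρ ] card c) R
    disjunct x≤n y≤n (last {s} {t} st∈R) = lose st∈R (inj₁ (whole s , whole t))
      where
      whole : ∀ {ρ} s {s≤n} → just (s , s≤n) ≡ eval M ρ (s · ė)
      -- `s · ė` evaluates to `s ++ []`, so string and bound are transported along `++-identityʳ`.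
      whole s {s≤n} = trans (cong just (Bounded-≡ (sym (++-identityʳ s))))
        (eval-push _ s ė {su≤n = subst (λ s → length s ≤ n) (sym (++-identityʳ s)) s≤n} refl)
    disjunct x≤n y≤n (more {s} {t} {u} {v} st∈R uv∈T lt) = lose st∈R (inj₂
      ( just (u , u≤n) , just (v , v≤n)
      , uv∈T
      , eval-push _ s (var 1) refl
      , eval-push _ t (var 0) refl
      , descent lt))
      where
      -- What remains after the card consists of suffixes, so it still lies in the domain.
      u≤n = ≤-trans (length-++-≤ʳ u {s}) x≤n
      v≤n = ≤-trans (length-++-≤ʳ v {t}) y≤n

      descent : length u < length (s ++ u) ⊎ (u ≡ s ++ u × length v < length (t ++ v)) →
                length u < length (s ++ u) ⊎
                (just (u , u≤n) ≡ just (s ++ u , x≤n) × length v < length (t ++ v))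
      descent (inj₁ u<)         = inj₁ u<
      descent (inj₂ (u≡ , v<)) = inj₂ (cong just (Bounded-≡ u≡) , v<)

  Shorter-irrefl : ∀ d → ¬ Shorter d d
  Shorter-irrefl (just _) = <-irrefl refl

  Shorter-trans : ∀ x y z → Shorter x y → Shorter y z → Shorter x z
  Shorter-trans (just _) (just _) (just _) = <-trans

  push≢e : ∀ {b} d → push b d ≢ just ([] , z≤n)
  push≢e {b} d eq with _ , _ , () ← push-just {b} {d} eq

  push-disjoint : ∀ x y → push true x ≡ push false y → push true x ≡ nothing
  push-disjoint x y eq with push true x in eqˣ
  ... | nothing = refl
  ... | just _
    with _ , _ , x≡ ← push-just {d = x} eqˣ
       | _ , _ , x≡′ ← push-just {d = y} (sym eq)
    with () ← trans (sym x≡) x≡′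

  ⊨-encode : ∀ {R s ρ} → length s ≤ n → (s , s) ∈ T →
             (∀ {x y} → (x , y) ∈ T → Decomposes R T x y) → M ⊨[ ρ ] encode R
  ⊨-encode s≤n ss∈T dec =
      (refl , refl)
    , (push≢e , push≢e)
    , ( (λ x y eq ≢⋆ → proj₂ (push-injective {d = x} eq ≢⋆))
      , (λ x y eq ≢⋆ → proj₂ (push-injective {d = x} eq ≢⋆)))
    , push-disjoint
    , Shorter-irrefl
    , Shorter-trans
    , ⊨-derivable dec
    , just (_ , s≤n) , ss∈T , λ ()

BPCP⇒FSATEQ : ∀ R → BPCP R → FSATEQ ΣBPCP ≡ʳ refl (encode R)
BPCP⇒FSATEQ R (s , d) =
  -- `⊨-encode` holds for every assignment, so a constant one will do.
  D , M , (λ _ → nothing)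
  , Maybe-finite (Bounded-finite _)
  , M-decidable
  , (λ _ _ → mk⇔ (λ eq → eq) (λ eq → eq))
  , ⊨-encode ≤-refl (root∈pairs d) (pairs-decompose d)
  -- With this bound the solution `s` itself just fits into the domain.
  where open BoundedModel (length s) (pairs d)

-- From models to solutions.

-- Heads are peeled off in parallel, and `f b x ≢ e` excludes different lengths. The tail differs
-- from `⋆` as well, because `f b` fixes `⋆`.
foldr-injective : ∀ {D : Set} {⋆ e : D} (f : Bool → D → D) →
                  (∀ b → f b ⋆ ≡ ⋆) → (∀ b x → f b x ≢ e) →
                  (∀ b c x y → f b x ≡ f c y → f b x ≢ ⋆ → b ≡ c × x ≡ y) →
                  ∀ s t → foldr f e s ≡ foldr f e t → foldr f e s ≢ ⋆ → s ≡ t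
foldr-injective {⋆ = ⋆} {e} f f⋆ f≢e f-inj = go
  where
  go : ∀ s t → foldr f e s ≡ foldr f e t → foldr f e s ≢ ⋆ → s ≡ t
  go []      []      _  _  = refl
  go []      (c ∷ t) eq _  = contradiction (sym eq) (f≢e c _)
  go (b ∷ s) []      eq _  = contradiction eq (f≢e b _)
  go (b ∷ s) (c ∷ t) eq ≢⋆ with refl , eq′ ← f-inj b c _ _ eq ≢⋆ =
    cong (b ∷_) (go s t eq′ λ s≡⋆ → ≢⋆ (trans (cong (f b) s≡⋆) (f⋆ b)))

module _ {D : Set} (M : Model ΣBPCP D)
         (≡-standard : ∀ x y → binary M ≡ʳ refl x y ⇔ x ≡ y) where

  private
    infix 4 _≺_
    _≺_ P : D → D → Set
    x ≺ y = relI M ≺ʳ (x ∷ y ∷ [])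
    P x y = relI M Pʳ (x ∷ y ∷ [])

    e : D
    e = funI M eᶠ []

    decode : BString → D
    decode = foldr (app M) e

    ≡⇒ : ∀ {x y} → relI M ≡ʳ (x ∷ y ∷ []) → x ≡ y
    ≡⇒ = to (≡-standard _ _)

    ≡⇐ : ∀ {x y} → x ≡ y → relI M ≡ʳ (x ∷ y ∷ [])
    ≡⇐ = from (≡-standard _ _)

    _≺ₗₑₓ_ : D × D → D × D → Set
    _≺ₗₑₓ_ = ×-Lex _≡_ _≺_ _≺_

    -- Induction on accessibility: the disjunct that holds at `(x , y)` names a card of `R`, which
    -- either ends the derivation or is put in front of the one obtained for a smaller pair.
    derivation : ∀ {R ρ x y} → M ⊨[ ρ ] derivable R → Acc _≺ₗₑₓ_ (x , y) → P x y →
                 ∃[ s ] ∃[ t ] (R ▷ s / t × x ≡ decode s × y ≡ decode t)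
    derivation {R} {x = x} {y} ⊨d (acc rs) Pxy
      with find (to (⊨-⋁ M R card) (⊨d x y Pxy))
    ... | (s , t) , st∈R , inj₁ (x≡ , y≡) =
      s , t , base st∈R , trans (≡⇒ x≡) (eval-· M _ s ė) , trans (≡⇒ y≡) (eval-· M _ t ė)
    ... | (s , t) , st∈R , inj₂ (u , v , Puv , x≡ , y≡ , lt) =
      -- Once `≡ʳ` is read as equality, the last conjunct of `card` is exactly the lexicographic
      -- order.
      extend (derivation ⊨d (rs (Sum.map₂ (Product.map₁ ≡⇒) lt)) Puv)
      where
      prepend : ∀ {z ρ} s s′ τ → relI M ≡ʳ (z ∷ eval M ρ (s · τ) ∷ []) →
                eval M ρ τ ≡ decode s′ → z ≡ decode (s ++ s′)
      prepend s s′ τ z≡ τ≡ = trans (≡⇒ z≡) (trans (eval-· M _ s τ)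
        (trans (cong (λ d → foldr (app M) d s) τ≡) (sym (foldr-++ (app M) e s s′))))

      extend : ∃[ s ] ∃[ t ] (R ▷ s / t × u ≡ decode s × v ≡ decode t) →
               ∃[ s ] ∃[ t ] (R ▷ s / t × x ≡ decode s × y ≡ decode t)
      extend (s′ , t′ , d , u≡ , v≡) =
        s ++ s′ , t ++ t′ , step st∈R d , prepend s s′ (var 1) x≡ u≡ , prepend t t′ (var 0) y≡ v≡

  -- Unfolding the pair `(x , x)` from `solvable` gives two strings that decode to the same `x`. As
  -- `x` is not `⋆`, decoding is injective there and the strings coincide.
  ⊨-encode⇒BPCP : ∀ {R ρ} → IsFinite D → M ⊨[ ρ ] encode R → BPCP R
  ⊨-encode⇒BPCP {R} fin
    ((f⋆ᵗ , f⋆ᶠ) , (f≢eᵗ , f≢eᶠ) , (injᵗ , injᶠ) , disj , irr , tr , ⊨d , x , Pxx , x≢⋆) =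
    solution (derivation ⊨d (×-wellFounded ≺-wf ≺-wf (x , x)) Pxx)
    where
    ⋆ : D
    ⋆ = funI M ⋆ᶠ []

    ≺-wf : WellFounded _≺_
    ≺-wf = finite-wellFounded fin irr (tr _ _ _)

    app-⋆ : ∀ b → app M b ⋆ ≡ ⋆
    app-⋆ true  = ≡⇒ f⋆ᵗ
    app-⋆ false = ≡⇒ f⋆ᶠ

    app≢e : ∀ b x → app M b x ≢ e
    app≢e true  x = f≢eᵗ x ∘ ≡⇐
    app≢e false x = f≢eᶠ x ∘ ≡⇐

    app-injective : ∀ b c x y → app M b x ≡ app M c y → app M b x ≢ ⋆ → b ≡ c × x ≡ y
    app-injective true  true  x y eq ≢⋆ = refl , ≡⇒ (injᵗ x y (≡⇐ eq) (≢⋆ ∘ ≡⇒))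
    app-injective false false x y eq ≢⋆ = refl , ≡⇒ (injᶠ x y (≡⇐ eq) (≢⋆ ∘ ≡⇒))
    app-injective true  false x y eq ≢⋆ = contradiction (≡⇒ (disj x y (≡⇐ eq))) ≢⋆
    -- `disjoint` has `ttᶠ` on its left, so this case applies it to the swapped elements.
    app-injective false true  x y eq ≢⋆ =
      contradiction (trans eq (≡⇒ (disj y x (≡⇐ (sym eq))))) ≢⋆

    solution : ∃[ s ] ∃[ t ] (R ▷ s / t × x ≡ decode s × x ≡ decode t) → BPCP R
    solution (s , t , d , x≡s , x≡t) = s , subst (R ▷ s /_) (sym s≡t) d
      where
      s≡t : s ≡ t
      s≡t = foldr-injective (app M) app-⋆ app≢e app-injective s t (trans (sym x≡s) x≡t)
              (x≢⋆ ∘ ≡⇐ ∘ trans x≡s)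

theorem14 : BPCP ⪯ FSATEQ ΣBPCP ≡ʳ refl
theorem14 = encode , λ R → mk⇔ (BPCP⇒FSATEQ R)
  λ (D , M , ρ , fin , _ , ≡-standard , ⊨φ) → ⊨-encode⇒BPCP M ≡-standard fin ⊨φ
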